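{- Let $\sigma$ be a finite vocabulary containing two distinct constant symbols $c$ and $d$. There does not exist a formula $\varphi$ of index logic $\mathrm{IL(IFP)}$ of vocabulary $\sigma$ that does not use the order predicate $\le$ on terms of sort $\mathbf{v}$ and that is equivalent to the formula $c\le d$ (i.e. such that for all finite ordered $\sigma$-structures $\mathbf{A}$ and all valuations $\mathit{val}$ over $\mathbf{A}$: $\mathbf{A},\mathit{val}\models\varphi$ iff $c^{\mathbf{A}}\le d^{\mathbf{A}}$).
   Context: **Structures.** A finite vocabulary $\sigma$ consists of finitely many relation symbols, constant symbols and function symbols (interpreted by total functions). A finite ordered $\sigma$-structure $\mathbf{A}$ is a finite structure of vocabulary $\sigma\cup\{\le\}$, $\le\,\notin\sigma$, with $\le^{\mathbf{A}}$ a linear order on $A$. One assumes the domain is $A=\{0,\dots,n-1\}$ with its natural order. $\log$ is the binary logarithm. **Index logic $\mathrm{IL(IFP)}$.** For $\mathbf{A}$ with $|A|=n$ let $\mathit{Num}(\mathbf{A})=\{0,\dots,\lceil\log n\rceil-1\}$. The logic is two-sorted: variables $x,y,\dots$ of sort $\mathbf{v}$ range over $A$; variables $\mathtt{x},\mathtt{y},\dots$ of sort $\mathbf{n}$ range over $\mathit{Num}(\mathbf{A})$; relation variables $X,Y,\dots$ of arity $r$ range over subsets of $\mathit{Num}(\mathbf{A})^r$. The only terms of sort $\mathbf{n}$ are the variables of sort $\mathbf{n}$; terms of sort $\mathbf{v}$ are $t::=x\mid c\mid f(t,\dots,t)$ with $c$ a constant symbol and $f$ a function symbol of $\sigma$.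 Formulas: $$\varphi::= t_1\le t_2\mid \mathtt{x}_1\le\mathtt{x}_2\mid R(t_1,\dots,t_k)\mid X(\mathtt{x}_1,\dots,\mathtt{x}_k)\mid(\varphi\wedge\varphi)\mid\neg\varphi\mid[\mathrm{IFP}_{\bar{\mathtt{x}},X}\varphi]\bar{\mathtt{y}}\mid t=\mathit{index}\{\mathtt{x}:\varphi(\mathtt{x})\}\mid\exists x(x=\mathit{index}\{\mathtt{x}:\alpha(\mathtt{x})\}\wedge\varphi)\mid\exists\mathtt{x}\,\varphi,$$ where $t,t_i$ are terms of sort $\mathbf{v}$, $R\in\sigma$ is a relation symbol, $\bar{\mathtt{x}},\bar{\mathtt{y}}$ are tuples of sort-$\mathbf{n}$ variables of length the arity of $X$, and $x$ does not occur free in $\alpha(\mathtt{x})$. A valuation $\mathit{val}$ assigns to variables values in their ranges and extends to terms as usual; $\mathit{val}(B/\chi)$ changes the value of $\chi$ to $B$. Semantics: atomic formulas $t_1\leq t_2$, $\mathtt{x}_1\le\mathtt{x}_2$, $R(\ldots)$, $X(\ldots)$, Boolean connectives and $\exists\mathtt{x}\,\varphi$ (quantification over $\mathit{Num}(\mathbf{A})$) are as usual; - $\mathbf{A},\mathit{val}\models t=\mathit{index}\{\mathtt{x}:\varphi(\mathtt{x})\}$ iff $\mathit{val}(t)$ in binary is $b_mb_{m-1}\cdots b_0$, where $m=\lceil\log|A|\rceil-1$ and $b_j=1$ iff $\mathbf{A},\mathit{val}(j/\mathtt{x})\models\varphi(\mathtt{x})$; - $\mathbf{A},\mathit{val}\models\exists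 x(x=\mathit{index}\{\mathtt{x}:\alpha(\mathtt{x})\}\wedge\varphi)$ iff there is $i\in A$ with $\mathbf{A},\mathit{val}(i/x)\models x=\mathit{index}\{\mathtt{x}:\alpha(\mathtt{x})\}$ and $\mathbf{A},\mathit{val}(i/x)\models\varphi$; - $\mathbf{A},\mathit{val}\models[\mathrm{IFP}_{\bar{\mathtt{x}},X}\varphi]\bar{\mathtt{y}}$ iff $\mathit{val}(\bar{\mathtt{y}})\in\mathrm{ifp}(F)$, where for $X$ of arity $k$ and $S\subseteq\mathit{Num}(\mathbf{A})^k$, $F(S)=\{\bar a\in\mathit{Num}(\mathbf{A})^k\mid\mathbf{A},\mathit{val}(S/X,\bar a/\bar{\mathtt{x}})\models\varphi\}$, and $\mathrm{ifp}(F)=\bigcup_i S^i$ with $S^0=\emptyset$, $S^{i+1}=S^i\cup F(S^i)$. A formula "does not use the order predicate on terms of sort $\mathbf{v}$" if it contains no atomic formula $t_1\le t_2$ with $t_1,t_2$ terms of sort $\mathbf{v}$; such a formula may still contain equality atoms $t_1=t_2$ between terms of sort $\mathbf{v}$ (with the usual meaning), and $\mathtt{x}_1\le\mathtt{x}_2$ on sort $\mathbf{n}$. -}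

module Defs where

open import Data.Digit using (Bit; fromDigits)
open import Data.Empty using (⊥)
open import Data.Fin using (Fin; toℕ; _≤_)
open import Data.Fin.Patterns using (1F)
open import Data.List using (List; []; _∷_; [_]; _++_; filter)
open import Data.List.Membership.Propositional using (_∉_)
open import Data.Nat using (ℕ; zero; suc)
import Data.Nat as ℕ
open import Data.Nat.Logarithm using (⌈log₂_⌉)
open import Data.Product using (_×_; ∃-syntax; Σ-syntax; proj₁)
open import Data.Product.Properties using (≡-dec)
open import Data.Unit using (⊤)
open import Data.Vec using (Vec; []; _∷_; toList; lookup)
import Data.Vec as Vec
open import Function.Bundles using (_⇔_)
open import Level using (0ℓ)
open import Relation.Binary.Definitions using (DecidableEquality)
open import Relation.Binary.PropositionalEquality using (_≡_; refl)
open import Relation.Nullary using (¬_; yes; no)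
open import Relation.Nullary.Decidable using (¬?)
open import Relation.Unary using (Pred; ∅; _∪_; ⋃)

record Vocabulary : Set where
  field
    #rel     : ℕ
    relArity : Fin #rel → ℕ
    #con     : ℕ
    #fun     : ℕ
    funArity : Fin #fun → ℕ

open Vocabulary public

-- The domain is Fin size; the linear order is the order _≤_ of Fin size.
record Structure (σ : Vocabulary) : Set₁ where
  field
    size : ℕ
    relᴬ : (R : Fin (#rel σ)) → Pred (Vec (Fin size) (relArity σ R)) 0ℓ
    conᴬ : Fin (#con σ) → Fin size
    funᴬ : (f : Fin (#fun σ)) → Vec (Fin size) (funArity σ f) → Fin size

open Structure public

Dom : ∀ {σ} → Structure σ → Set
Dom A = Fin (size A)

Num : ∀ {σ} → Structure σ → Set
Num A = Fin ⌈log₂ size A ⌉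

VVar NVar RVar : Set
VVar = ℕ
NVar = ℕ
RVar = ℕ × ℕ -- an arity and a name

arity : RVar → ℕ
arity = proj₁

infix 7 _≤ᵛ_ _≐_ _≤ⁿ_ _≐index_∶_
infix 6 ~_
infixr 5 _∧_

data Term (σ : Vocabulary) : Set where
  var : VVar → Term σ
  con : Fin (#con σ) → Term σ
  fun : (f : Fin (#fun σ)) → Vec (Term σ) (funArity σ f) → Term σ

fvᵗ  : ∀ {σ} → Term σ → List VVar
fvᵗˢ : ∀ {σ k} → Vec (Term σ) k → List VVar

fvᵗ (var x)    = [ x ]
fvᵗ (con c)    = []
fvᵗ (fun f ts) = fvᵗˢ ts

fvᵗˢ []       = []
fvᵗˢ (t ∷ ts) = fvᵗ t ++ fvᵗˢ ts

data Formula (σ : Vocabulary) : Set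

-- Free variables of sort v only.
fv : ∀ {σ} → Formula σ → List VVar

-- Equality of terms of sort v is definable from _≤ᵛ_; it is a separate atom so
-- that it stays available in formulas without _≤ᵛ_.
data Formula σ where
  _≤ᵛ_       : Term σ → Term σ → Formula σ
  _≐_        : Term σ → Term σ → Formula σ
  _≤ⁿ_       : NVar → NVar → Formula σ
  rel        : (R : Fin (#rel σ)) → Vec (Term σ) (relArity σ R) → Formula σ
  rvar       : (X : RVar) → Vec NVar (arity X) → Formula σ
  _∧_        : Formula σ → Formula σ → Formula σ
  ~_         : Formula σ → Formula σ
  -- ifp X x̄ φ ȳ is [IFP_{x̄,X} φ] ȳ
  ifp        : (X : RVar) (x̄ : Vec NVar (arity X)) → Formula σ →
               (ȳ : Vec NVar (arity X)) → Formula σ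
  _≐index_∶_ : Term σ → NVar → Formula σ → Formula σ
  -- ∃index x 𝕩 α _ φ is ∃x (x = index{𝕩 : α} ∧ φ)
  ∃index     : (x : VVar) (𝕩 : NVar) (α : Formula σ) → x ∉ fv α →
               Formula σ → Formula σ
  ∃ⁿ         : NVar → Formula σ → Formula σ

fv (s ≤ᵛ t)            = fvᵗ s ++ fvᵗ t
fv (s ≐ t)             = fvᵗ s ++ fvᵗ t
fv (𝕩 ≤ⁿ 𝕪)            = []
fv (rel R ts)          = fvᵗˢ ts
fv (rvar X 𝕩s)         = []
fv (φ ∧ ψ)             = fv φ ++ fv ψ
fv (~ φ)               = fv φ
fv (ifp X x̄ φ ȳ)       = fv φ
fv (t ≐index 𝕩 ∶ φ)    = fvᵗ t ++ fv φ
fv (∃index x 𝕩 α _ φ)  = filter (λ y → ¬? (y ℕ.≟ x)) (fv α ++ fv φ)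
fv (∃ⁿ 𝕩 φ)            = fv φ

NoVOrder : ∀ {σ} → Formula σ → Set
NoVOrder (s ≤ᵛ t)           = ⊥
NoVOrder (s ≐ t)            = ⊤
NoVOrder (𝕩 ≤ⁿ 𝕪)           = ⊤
NoVOrder (rel R ts)         = ⊤
NoVOrder (rvar X 𝕩s)        = ⊤
NoVOrder (φ ∧ ψ)            = NoVOrder φ × NoVOrder ψ
NoVOrder (~ φ)              = NoVOrder φ
NoVOrder (ifp X x̄ φ ȳ)      = NoVOrder φ
NoVOrder (t ≐index 𝕩 ∶ φ)   = NoVOrder φ
NoVOrder (∃index x 𝕩 α _ φ) = NoVOrder α × NoVOrder φ
NoVOrder (∃ⁿ 𝕩 φ)           = NoVOrder φ

update : ∀ {a b} {I : Set a} {B : I → Set b} → DecidableEquality I →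
         (∀ i → B i) → (i : I) → B i → ∀ j → B j
update _≟_ f i b j with i ≟ j
... | yes refl = b
... | no _     = f j

-- Num A is empty when size A ≡ 1, so such A have no valuations.
record Valuation {σ} (A : Structure σ) : Set₁ where
  field
    vval : VVar → Dom A
    nval : NVar → Num A
    rval : (X : RVar) → Pred (Vec (Num A) (arity X)) 0ℓ

open Valuation public

module _ {σ} {A : Structure σ} where

  infixl 8 _[_↦ᵛ_] _[_↦ⁿ_] _[_↦ⁿˢ_] _[_↦ʳ_]

  _[_↦ᵛ_] : Valuation A → VVar → Dom A → Valuation A
  val [ x ↦ᵛ a ] = record val { vval = update ℕ._≟_ (vval val) x a }

  _[_↦ⁿ_] : Valuation A → NVar → Num A → Valuation A
  val [ 𝕩 ↦ⁿ a ] = record val { nval = update ℕ._≟_ (nval val) 𝕩 a }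

  -- If a variable is repeated in the tuple, its last occurrence counts.
  _[_↦ⁿˢ_] : ∀ {k} → Valuation A → Vec NVar k → Vec (Num A) k → Valuation A
  val [ []     ↦ⁿˢ []      ] = val
  val [ 𝕩 ∷ 𝕩s ↦ⁿˢ a ∷ as ] = val [ 𝕩 ↦ⁿ a ] [ 𝕩s ↦ⁿˢ as ]

  _[_↦ʳ_] : Valuation A → (X : RVar) → Pred (Vec (Num A) (arity X)) 0ℓ → Valuation A
  val [ X ↦ʳ S ] = record val { rval = update (≡-dec ℕ._≟_ ℕ._≟_) (rval val) X S }

  ⟦_⟧  : Term σ → Valuation A → Dom A
  ⟦_⟧ˢ : ∀ {k} → Vec (Term σ) k → Valuation A → Vec (Dom A) k

  ⟦ var x ⟧    val = vval val x
  ⟦ con c ⟧    val = conᴬ A c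
  ⟦ fun f ts ⟧ val = funᴬ A f (⟦ ts ⟧ˢ val)

  ⟦ [] ⟧ˢ     val = []
  ⟦ t ∷ ts ⟧ˢ val = ⟦ t ⟧ val ∷ ⟦ ts ⟧ˢ val

-- i is the number with binary digits b_{k-1} ⋯ b_0, where b_j = 1 iff P j.
-- (fromDigits expects the least significant digit first.)
IsIndex : ∀ {n k} → Fin n → Pred (Fin k) 0ℓ → Set
IsIndex {k = k} i P = Σ[ b ∈ Vec Bit k ]
  toℕ i ≡ fromDigits (toList b) × (∀ j → lookup b j ≡ 1F ⇔ P j)

Stage : ∀ {I : Set} → (Pred I 0ℓ → Pred I 0ℓ) → ℕ → Pred I 0ℓ
Stage F zero    = ∅
Stage F (suc i) = Stage F i ∪ F (Stage F i)

Ifp : ∀ {I : Set} → (Pred I 0ℓ → Pred I 0ℓ) → Pred I 0ℓ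
Ifp F = ⋃[ i ∶ ℕ ] Stage F i

infix 4 _∣_⊨_ _≋_

_∣_⊨_ : ∀ {σ} (A : Structure σ) → Valuation A → Formula σ → Set
A ∣ val ⊨ s ≤ᵛ t           = ⟦ s ⟧ val ≤ ⟦ t ⟧ val
A ∣ val ⊨ s ≐ t            = ⟦ s ⟧ val ≡ ⟦ t ⟧ val
A ∣ val ⊨ 𝕩 ≤ⁿ 𝕪           = nval val 𝕩 ≤ nval val 𝕪
A ∣ val ⊨ rel R ts         = relᴬ A R (⟦ ts ⟧ˢ val)
A ∣ val ⊨ rvar X 𝕩s        = rval val X (Vec.map (nval val) 𝕩s)
A ∣ val ⊨ φ ∧ ψ            = A ∣ val ⊨ φ × A ∣ val ⊨ ψ
A ∣ val ⊨ ~ φ              = ¬ (A ∣ val ⊨ φ)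
A ∣ val ⊨ ifp X x̄ φ ȳ      =
  Ifp (λ S ā → A ∣ val [ X ↦ʳ S ] [ x̄ ↦ⁿˢ ā ] ⊨ φ) (Vec.map (nval val) ȳ)
A ∣ val ⊨ t ≐index 𝕩 ∶ φ   =
  IsIndex (⟦ t ⟧ val) (λ j → A ∣ val [ 𝕩 ↦ⁿ j ] ⊨ φ)
A ∣ val ⊨ ∃index x 𝕩 α _ φ = ∃[ i ]
  IsIndex (⟦ var x ⟧ (val [ x ↦ᵛ i ])) (λ j → A ∣ val [ x ↦ᵛ i ] [ 𝕩 ↦ⁿ j ] ⊨ α) ×
  A ∣ val [ x ↦ᵛ i ] ⊨ φ
A ∣ val ⊨ ∃ⁿ 𝕩 φ           = ∃[ j ] A ∣ val [ 𝕩 ↦ⁿ j ] ⊨ φ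

_≋_ : ∀ {σ} → Formula σ → Formula σ → Set₁
φ ≋ ψ = ∀ A (val : Valuation A) → A ∣ val ⊨ φ ⇔ A ∣ val ⊨ ψ

{-# OPTIONS --safe #-}

-- Interpret c and d by p true and p false and everything else trivially.  Unless
-- some index{𝕩 : α} met during the evaluation of φ equals p true or p false, the
-- evaluation can be carried out symbolically, without knowing p.  The number of
-- indices met is polynomial in m = log n, because an inductive fixed point of
-- arity k has at most 1 + m^k stages.  So for large n some injective p avoids all
-- of them, and then φ cannot tell p from p ∘ not, which exchanges c and d.

module Submission where

open import Data.Bool using (Bool; true; false; T; not; if_then_else_)
import Data.Bool as Bool
import Data.Bool.Properties as Bool
open import Data.Digit using (Bit; fromDigits)
open import Data.Empty using (⊥)
open import Data.Fin using (Fin; toℕ; fromℕ<; combine; remQuot; _≤_)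
import Data.Fin as Fin
import Data.Fin.Properties as Fin
open import Data.Fin.Patterns using (0F; 1F)
open import Data.Fin.Subset using (Subset; _∈_; _∪_; ∣_∣) renaming (⊥ to ∅ˢ)
open import Data.Fin.Subset.Properties
  using (_∈?_; ∉⊥; ∪⇔⊎; p⊆p∪q; q⊆p∪q; x∈p∪q⁻; ⊆-antisym; p⊂q⇒∣p∣<∣q∣; ∣p∣≤n)
open import Data.List using (List; []; _∷_; _++_; length; concatMap; allFin; upTo)
import Data.List as List
open import Data.List.Membership.Propositional using (lose) renaming (_∈_ to _∈ˡ_; _∉_ to _∉ˡ_)
open import Data.List.Membership.Propositional.Properties
  using (∈-++⁺ˡ; ∈-++⁺ʳ; ∈-concatMap⁺; ∈-allFin; ∈-upTo⁺; ∈-filter⁺)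
import Data.List.Membership.DecPropositional as DecMembership
open import Data.List.Properties using (length-++; length-tabulate; length-upTo)
open import Data.List.Relation.Unary.Any using (here; there; index)
open import Data.List.Relation.Unary.Any.Properties using (lookup-index)
open import Data.Nat using (ℕ; zero; suc; _+_; _*_; _^_; _⊓_; _∸_; z≤n; s≤s)
import Data.Nat as ℕ
open import Data.Nat.Logarithm using (⌈log₂_⌉; ⌈log₂2^n⌉≡n)
import Data.Nat.Properties as ℕ
open import Data.Product using (_×_; _,_; ∃-syntax; proj₁; proj₂)
open import Data.Product.Function.NonDependent.Propositional using (_×-⇔_)
open import Data.Product.Properties using (≡-dec)
open import Data.Sum using (_⊎_; inj₁; inj₂; [_,_])
open import Data.Sum.Function.Propositional using (_⊎-⇔_)
import Data.Sum.Properties as Sum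
open import Data.Unit using (⊤; tt)
open import Data.Vec using (Vec; []; _∷_; toList; lookup; tabulate)
import Data.Vec as Vec
open import Data.Vec.Properties using ([]=⇒lookup; lookup⇒[]=; lookup∘tabulate; map-cong)
open import Data.Vec.Relation.Binary.Pointwise.Extensional using (ext; Pointwise-≡⇒≡)
open import Function using (_∘_; id; _⇔_; mk⇔)
open import Function.Bundles using (module Equivalence)
open import Function.Definitions using (Injective)
open import Function.Properties.Equivalence using ()
  renaming (sym to ⇔-sym; trans to ⇔-trans)
open import Function.Related.TypeIsomorphisms using (¬-cong-⇔)
open import Level using (0ℓ)
open import Relation.Binary.Definitions using (DecidableEquality)
open import Relation.Binary.PropositionalEquality
  using (_≡_; _≢_; refl; sym; trans; cong; cong₂; subst; module ≡-Reasoning)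
open import Relation.Nullary using (¬_; Dec; yes; no; does; contradiction)
open import Relation.Nullary.Decidable
  using (⌊_⌋; toWitness; fromWitness; dec-true; dec-false; ¬?; _×-dec_; T?)
open import Relation.Unary using (Pred)
open import Defs

open Equivalence using (to; from)

-- Updates of valuations and codes of tuples

module _ {a b} {I : Set a} (_≟_ : DecidableEquality I) {B : I → Set b} where

  update-same : (f : ∀ i → B i) → ∀ i {x} → update _≟_ f i x i ≡ x
  update-same f i with i ≟ i
  ... | yes refl = refl
  ... | no i≢i   = contradiction refl i≢i

  update-other : (f : ∀ i → B i) → ∀ {i j x} → i ≢ j → update _≟_ f i x j ≡ f j
  update-other f {i} {j} i≢j with i ≟ j
  ... | yes i≡j = contradiction i≡j i≢j
  ... | no _    = refl

  -- `others` is asked only away from `i`: a variable that is about to be bound need not match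
  -- beforehand.
  update-related : ∀ {c ℓ} {C : I → Set c} (R : ∀ i → B i → C i → Set ℓ) {f g} i {x y} →
    (∀ j → i ≢ j → R j (f j) (g j)) → R i x y →
    ∀ j → R j (update _≟_ f i x j) (update _≟_ g i y j)
  update-related R i others same j with i ≟ j
  ... | yes refl = same
  ... | no i≢j   = others j i≢j

-- Through these codes a relation on numbers becomes a subset of `Fin (m ^ k)`, whose cardinality
-- bounds the number of stages.
encode : ∀ {m k} → Vec (Fin m) k → Fin (m ^ k)
encode []       = 0F
encode (a ∷ as) = combine a (encode as)

decode : ∀ {m k} → Fin (m ^ k) → Vec (Fin m) k
decode {k = zero}      _ = []
decode {m} {k = suc k} i = proj₁ (remQuot (m ^ k) i) ∷ decode (proj₂ (remQuot {m} (m ^ k) i))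

decode∘encode : ∀ {m k} (as : Vec (Fin m) k) → decode (encode as) ≡ as
decode∘encode []               = refl
decode∘encode (a ∷ as) = trans
  (cong (λ (b , i) → b ∷ decode i) (Fin.remQuot-combine a (encode as)))
  (cong (a ∷_) (decode∘encode as))

⌊⌋⇔ : ∀ {p} {P : Set p} (P? : Dec P) → P ⇔ T ⌊ P? ⌋
⌊⌋⇔ P? = mk⇔ (fromWitness {a? = P?}) toWitness

∈-tabulate : ∀ {n} {f : Fin n → Bool} {i} → i ∈ tabulate f ⇔ T (f i)
∈-tabulate {f = f} {i} = mk⇔
  (λ i∈ → from Bool.T-≡ (trans (sym (lookup∘tabulate f i)) ([]=⇒lookup i∈)))
  (λ fi → lookup⇒[]= i _ (trans (lookup∘tabulate f i) (to Bool.T-≡ fi)))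

T-not⇔ : ∀ b → (¬ T b) ⇔ T (not b)
T-not⇔ true  = mk⇔ (λ ¬t → ¬t tt) (λ ())
T-not⇔ false = mk⇔ (λ _ → tt) (λ _ ())

-- Inflationary stages on a finite set

module _ {N : ℕ} (F : Subset N → Subset N) where

  stage : ℕ → Subset N
  stage zero    = ∅ˢ
  stage (suc i) = stage i ∪ F (stage i)

  fixed⊎grows : ∀ S → S ∪ F S ≡ S ⊎ ∣ S ∣ ℕ.< ∣ S ∪ F S ∣
  fixed⊎grows S with Fin.any? (λ x → (x ∈? F S) ×-dec ¬? (x ∈? S))
  ... | yes (x , x∈FS , x∉S) = inj₂ (p⊂q⇒∣p∣<∣q∣ (p⊆p∪q (F S) , x , q⊆p∪q S (F S) x∈FS , x∉S))
  ... | no ∄x = inj₁ (⊆-antisym ⊆S (p⊆p∪q (F S)))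
    where
    ⊆S : ∀ {x} → x ∈ S ∪ F S → x ∈ S
    ⊆S {x} x∈ with x∈p∪q⁻ S (F S) x∈ | x ∈? S
    ... | inj₁ x∈S  | _       = x∈S
    ... | inj₂ x∈FS | yes x∈S = x∈S
    ... | inj₂ x∈FS | no x∉S  = contradiction (x , x∈FS , x∉S) ∄x

  -- Each step adds an element until one is stationary, and from then on all are, since a stage
  -- determines the next.
  stage-fixed⊎large : ∀ i → stage (suc i) ≡ stage i ⊎ i ℕ.< ∣ stage (suc i) ∣
  stage-fixed⊎large zero with fixed⊎grows (stage 0)
  ... | inj₁ fixed = inj₁ fixed
  ... | inj₂ grows = inj₂ (ℕ.≤-<-trans z≤n grows)
  stage-fixed⊎large (suc i) with stage-fixed⊎large i | fixed⊎grows (stage (suc i))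
  ... | inj₁ fixed | _          = inj₁ (cong (λ S → S ∪ F S) fixed)
  ... | inj₂ large | inj₁ fixed = inj₁ fixed
  ... | inj₂ large | inj₂ grows = inj₂ (ℕ.≤-<-trans large grows)

  stage-fixed : stage (suc N) ≡ stage N
  stage-fixed with stage-fixed⊎large N
  ... | inj₁ fixed = fixed
  ... | inj₂ large = contradiction (∣p∣≤n (stage (suc N))) (ℕ.<⇒≱ large)

  stage-beyond : ∀ j → stage (j + N) ≡ stage N
  stage-beyond zero    = refl
  stage-beyond (suc j) = trans (cong (λ S → S ∪ F S) (stage-beyond j)) stage-fixed

  stage-increasing : ∀ j {i x} → x ∈ stage i → x ∈ stage (j + i)
  stage-increasing zero    x∈ = x∈
  stage-increasing (suc j) x∈ = p⊆p∪q _ (stage-increasing j x∈)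

  -- Going up `N` stages from `i` ends at stage `i + N`, which is already the limit; this avoids
  -- comparing `i` with `N`.
  stage⊆limit : ∀ i {x} → x ∈ stage i → x ∈ stage N
  stage⊆limit i {x} x∈ = subst (x ∈_) (stage-beyond i)
    (subst (λ j → x ∈ stage j) (ℕ.+-comm N i) (stage-increasing N x∈))

  -- Reduces all stages to the stages 0 to `N`, the ones that `reached` lists.
  stage-⊓ : ∀ i → stage (i ⊓ N) ≡ stage i
  stage-⊓ i with ℕ.≤-total i N
  ... | inj₁ i≤N = cong stage (ℕ.m≤n⇒m⊓n≡m i≤N)
  ... | inj₂ N≤i = begin
    stage (i ⊓ N)     ≡⟨ cong stage (ℕ.m≥n⇒m⊓n≡n N≤i) ⟩
    stage N           ≡⟨ stage-beyond (i ∸ N) ⟨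
    stage (i ∸ N + N) ≡⟨ cong stage (ℕ.m∸n+n≡m N≤i) ⟩
    stage i           ∎
    where open ≡-Reasoning

-- Binary notation

fromDigits<2^ : ∀ {k} (b : Vec Bit k) → fromDigits (toList b) ℕ.< 2 ^ k
fromDigits<2^ []       = s≤s z≤n
fromDigits<2^ {suc k} (d ∷ b) = begin-strict
  toℕ d + fromDigits (toList b) * 2 <⟨ ℕ.+-monoˡ-< _ (Fin.toℕ<n d) ⟩
  suc (fromDigits (toList b)) * 2   ≤⟨ ℕ.*-monoˡ-≤ 2 (fromDigits<2^ b) ⟩
  2 ^ k * 2                         ≡⟨ ℕ.*-comm (2 ^ k) 2 ⟩
  2 ^ suc k                         ∎
  where open ℕ.≤-Reasoning

digit : Bool → Bit
digit b = if b then 1F else 0F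

digit≡1⇔ : ∀ {b} → digit b ≡ 1F ⇔ T b
digit≡1⇔ {true}  = mk⇔ (λ _ → tt) (λ _ → refl)
digit≡1⇔ {false} = mk⇔ (λ ()) (λ ())

bit-ext : {x y : Bit} → x ≡ 1F ⇔ y ≡ 1F → x ≡ y
bit-ext {0F} {0F} _  = refl
bit-ext {0F} {1F} eq = from eq refl
bit-ext {1F} {0F} eq = sym (to eq refl)
bit-ext {1F} {1F} _  = refl

module _ {n k : ℕ} (2^k≤n : 2 ^ k ℕ.≤ n) where

  -- Because `2 ^ k` is at most `n`, every word of `k` bits names an element, so taking the index is
  -- a total operation.
  indexOf : (Fin k → Bool) → Fin n
  indexOf f = fromℕ< (ℕ.<-≤-trans (fromDigits<2^ (tabulate (digit ∘ f))) 2^k≤n)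

  -- A bit is determined by whether it equals 1, so `P` fixes every digit and thereby `i`.
  isIndex⇔≡indexOf : ∀ {i : Fin n} {P : Pred (Fin k) 0ℓ} {f} → (∀ j → P j ⇔ T (f j)) →
    IsIndex i P ⇔ i ≡ indexOf f
  isIndex⇔≡indexOf {i} {P} {f} P⇔f = mk⇔
    (λ (b , i≡ , b⇔P) → Fin.toℕ-injective (begin
      toℕ i                      ≡⟨ i≡ ⟩
      fromDigits (toList b)      ≡⟨ cong (fromDigits ∘ toList) (unique b b⇔P) ⟩
      fromDigits (toList digits) ≡⟨ Fin.toℕ-fromℕ< _ ⟨
      toℕ (indexOf f)            ∎))
    (λ { refl → digits , Fin.toℕ-fromℕ< _ , digits⇔P })
    where
    open ≡-Reasoning
    digits = tabulate (digit ∘ f)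

    digits⇔P : ∀ j → lookup digits j ≡ 1F ⇔ P j
    digits⇔P j rewrite lookup∘tabulate (digit ∘ f) j =
      ⇔-trans digit≡1⇔ (⇔-sym (P⇔f j))

    unique : ∀ b → (∀ j → lookup b j ≡ 1F ⇔ P j) → b ≡ digits
    unique b b⇔P = Pointwise-≡⇒≡ (ext λ j → bit-ext (⇔-trans (b⇔P j) (⇔-sym (digits⇔P j))))

-- Counting

length-concatMap-≤ : ∀ {A B : Set} (f : A → List B) xs {b} → (∀ x → length (f x) ℕ.≤ b) →
  length (concatMap f xs) ℕ.≤ length xs * b
length-concatMap-≤ f []       f≤ = z≤n
length-concatMap-≤ f (x ∷ xs) f≤
  rewrite length-++ (f x) {concatMap f xs} = ℕ.+-mono-≤ (f≤ x) (length-concatMap-≤ f xs f≤)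

-- Otherwise sending each element to its position in `xs` would inject `Fin n` into fewer than `n`
-- positions.
∃-∉ : ∀ {n} (xs : List (Fin n)) → length xs ℕ.< n → ∃[ i ] i ∉ˡ xs
∃-∉ {n} xs |xs|<n = Fin.¬∀⟶∃¬ n (_∈ˡ xs) (λ i → DecMembership._∈?_ Fin._≟_ i xs) λ ∈xs →
  let i , j , i<j , eq = Fin.pigeonhole |xs|<n (index ∘ ∈xs)
  in Fin.<⇒≢ i<j (trans (lookup-index (∈xs i))
       (trans (cong (List.lookup xs) eq) (sym (lookup-index (∈xs j)))))

-- Both powers are at most `m ^ (a + b)`, and one more factor `m` absorbs the doubling. Lengths thus
-- stay bounded by pure powers of `m` whose exponent depends on the formula alone.
+≤^ : ∀ {m x y} a b → 2 ℕ.≤ m → x ℕ.≤ m ^ a → y ℕ.≤ m ^ b → x + y ℕ.≤ m ^ suc (a + b)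
+≤^ {m@(suc _)} {x} {y} a b 2≤m x≤ y≤ = begin
  x + y                           ≤⟨ ℕ.+-mono-≤ x≤ y≤ ⟩
  m ^ a + m ^ b                   ≤⟨ ℕ.+-mono-≤ (ℕ.^-monoʳ-≤ m (ℕ.m≤m+n a b))
                                                (ℕ.^-monoʳ-≤ m (ℕ.m≤n+m b a)) ⟩
  m ^ (a + b) + m ^ (a + b)       ≡⟨ cong (m ^ (a + b) +_) (ℕ.+-identityʳ _) ⟨
  2 * m ^ (a + b)                 ≤⟨ ℕ.*-monoˡ-≤ (m ^ (a + b)) 2≤m ⟩
  m ^ suc (a + b)                 ∎
  where open ℕ.≤-Reasoning

-- Symbolic environments

-- inj₁ i is the element i of the domain; inj₂ true and inj₂ false stand for the
-- values of c and d.
Value : ℕ → Set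
Value n = Fin n ⊎ Bool

_≟ᵛ_ : ∀ {n} → DecidableEquality (Value n)
_≟ᵛ_ = Sum.≡-dec Fin._≟_ Bool._≟_

record Env (n : ℕ) : Set where
  field
    vvalᵉ : VVar → Value n
    nvalᵉ : NVar → Fin ⌈log₂ n ⌉
    rvalᵉ : (X : RVar) → Subset (⌈log₂ n ⌉ ^ arity X)

open Env

module _ {n : ℕ} where

  infixl 8 _[_↦ᵛ_]ᵉ _[_↦ⁿ_]ᵉ _[_↦ⁿˢ_]ᵉ _[_↦ʳ_]ᵉ

  _[_↦ᵛ_]ᵉ : Env n → VVar → Value n → Env n
  env [ x ↦ᵛ u ]ᵉ = record env { vvalᵉ = update ℕ._≟_ (vvalᵉ env) x u }

  _[_↦ⁿ_]ᵉ : Env n → NVar → Fin ⌈log₂ n ⌉ → Env n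
  env [ 𝕩 ↦ⁿ a ]ᵉ = record env { nvalᵉ = update ℕ._≟_ (nvalᵉ env) 𝕩 a }

  _[_↦ⁿˢ_]ᵉ : ∀ {k} → Env n → Vec NVar k → Vec (Fin ⌈log₂ n ⌉) k → Env n
  env [ []     ↦ⁿˢ []     ]ᵉ = env
  env [ 𝕩 ∷ 𝕩s ↦ⁿˢ a ∷ as ]ᵉ = env [ 𝕩 ↦ⁿ a ]ᵉ [ 𝕩s ↦ⁿˢ as ]ᵉ

  _[_↦ʳ_]ᵉ : Env n → (X : RVar) → Subset (⌈log₂ n ⌉ ^ arity X) → Env n
  env [ X ↦ʳ S ]ᵉ = record env { rvalᵉ = update (≡-dec ℕ._≟_ ℕ._≟_) (rvalᵉ env) X S }

-- The exponent in `length-reached`. For `ifp`, `suc (arity X)` pays for the `1 + m ^ arity X`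
-- stages and the next `arity X` for the tuples at each stage.
degree : ∀ {σ} → Formula σ → ℕ
degree (s ≤ᵛ t)           = 0
degree (s ≐ t)            = 0
degree (𝕩 ≤ⁿ 𝕪)           = 0
degree (rel R ts)         = 0
degree (rvar X 𝕩s)        = 0
degree (φ ∧ ψ)            = suc (degree φ + degree ψ)
degree (~ φ)              = degree φ
degree (ifp X x̄ φ ȳ)      = suc (arity X) + (arity X + degree φ)
degree (t ≐index 𝕩 ∶ φ)   = suc (suc (degree φ))
degree (∃index x 𝕩 α _ φ) = suc (suc (suc (degree α)) + degree φ)
degree (∃ⁿ 𝕩 φ)           = suc (degree φ)

-- Symbolic evaluation

module Evaluation {σ : Vocabulary} (c : Fin (#con σ)) {n : ℕ} (full : 2 ^ ⌈log₂ n ⌉ ℕ.≤ n) where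

  private
    m = ⌈log₂ n ⌉

  -- Mirrors `𝔸` below: all constants other than `c` share one value, and functions constantly
  -- return the value of `c`.
  evalᵗ : Term σ → Env n → Value n
  evalᵗ (var x)    env = vvalᵉ env x
  evalᵗ (con e)    env = inj₂ (does (e Fin.≟ c))
  evalᵗ (fun f ts) env = inj₂ true

  eval : Formula σ → Env n → Bool

  operator : (X : RVar) → Vec NVar (arity X) → Formula σ → Env n →
    Subset (m ^ arity X) → Subset (m ^ arity X)
  operator X x̄ φ env S = tabulate λ i → eval φ (env [ X ↦ʳ S ]ᵉ [ x̄ ↦ⁿˢ decode i ]ᵉ)

  defined : NVar → Formula σ → Env n → Fin n
  defined 𝕩 φ env = indexOf full λ j → eval φ (env [ 𝕩 ↦ⁿ j ]ᵉ)

  -- A default value: `NoVOrder` excludes this atom.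
  eval (s ≤ᵛ t)           env = false
  eval (s ≐ t)            env = ⌊ evalᵗ s env ≟ᵛ evalᵗ t env ⌋
  eval (𝕩 ≤ⁿ 𝕪)           env = ⌊ nvalᵉ env 𝕩 Fin.≤? nvalᵉ env 𝕪 ⌋
  eval (rel R ts)         env = false
  eval (rvar X 𝕩s)        env = ⌊ encode (Vec.map (nvalᵉ env) 𝕩s) ∈? rvalᵉ env X ⌋
  eval (φ ∧ ψ)            env = eval φ env Bool.∧ eval ψ env
  eval (~ φ)              env = not (eval φ env)
  eval (ifp X x̄ φ ȳ)      env =
    ⌊ encode (Vec.map (nvalᵉ env) ȳ) ∈? stage (operator X x̄ φ env) (m ^ arity X) ⌋
  eval (t ≐index 𝕩 ∶ φ)   env = ⌊ evalᵗ t env ≟ᵛ inj₁ (defined 𝕩 φ env) ⌋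
  -- The index determines the witness, so the quantifier turns into an assignment.
  eval (∃index x 𝕩 α _ φ) env = eval φ (env [ x ↦ᵛ inj₁ (defined 𝕩 α env) ]ᵉ)
  eval (∃ⁿ 𝕩 φ)           env = ⌊ Fin.any? (λ j → T? (eval φ (env [ 𝕩 ↦ⁿ j ]ᵉ))) ⌋

  -- The elements that `p` has to avoid. As `p` does not occur here, the list is fixed before `p` is
  -- chosen.
  reached : Formula σ → Env n → List (Fin n)
  reached (s ≤ᵛ t)           env = []
  reached (s ≐ t)            env = []
  reached (𝕩 ≤ⁿ 𝕪)           env = []
  reached (rel R ts)         env = []
  reached (rvar X 𝕩s)        env = []
  reached (φ ∧ ψ)            env = reached φ env ++ reached ψ env
  reached (~ φ)              env = reached φ env
  reached (ifp X x̄ φ ȳ)      env =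
    concatMap (λ i →
      concatMap (λ a →
        reached φ (env [ X ↦ʳ stage (operator X x̄ φ env) i ]ᵉ [ x̄ ↦ⁿˢ decode a ]ᵉ))
        (allFin (m ^ arity X)))
      -- Stage `m ^ arity X` is included because it stands for all later stages as well.
      (upTo (suc (m ^ arity X)))
  reached (t ≐index 𝕩 ∶ φ)   env =
    defined 𝕩 φ env ∷ concatMap (λ j → reached φ (env [ 𝕩 ↦ⁿ j ]ᵉ)) (allFin m)
  reached (∃index x 𝕩 α _ φ) env =
    (defined 𝕩 α env ∷ concatMap (λ j → reached α (env [ 𝕩 ↦ⁿ j ]ᵉ)) (allFin m))
      ++ reached φ (env [ x ↦ᵛ inj₁ (defined 𝕩 α env) ]ᵉ)
  reached (∃ⁿ 𝕩 φ)           env = concatMap (λ j → reached φ (env [ 𝕩 ↦ⁿ j ]ᵉ)) (allFin m)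

  -- Soundness for every `p` that avoids the reached indices

  module Soundness (p : Bool → Fin n) (p-injective : Injective _≡_ _≡_ p) where

    𝔸 : Structure σ
    𝔸 = record
      { size = n
      ; relᴬ = λ _ _ → ⊥
      ; conᴬ = λ e → p (does (e Fin.≟ c))
      ; funᴬ = λ _ _ → p true
      }

    embed : Value n → Fin n
    embed = [ id , p ]

    Avoids : Value n → Set
    Avoids (inj₁ i) = ∀ b → p b ≢ i
    Avoids (inj₂ _) = ⊤

    -- A mixed pair is separated by `Avoids`, two `inj₂` values by injectivity of `p`. Hence
    -- equality atoms can be decided on symbolic values.
    embed-injective : ∀ {u v} → Avoids u → Avoids v → embed u ≡ embed v → u ≡ v
    embed-injective {inj₁ i} {inj₁ j} _  _  eq = cong inj₁ eq
    embed-injective {inj₁ i} {inj₂ b} u∌ _  eq = contradiction (sym eq) (u∌ b)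
    embed-injective {inj₂ b} {inj₁ j} _  v∌ eq = contradiction eq (v∌ b)
    embed-injective {inj₂ b} {inj₂ d} _  _  eq = cong inj₂ (p-injective eq)

    Fresh : List (Fin n) → Set
    Fresh xs = ∀ b → p b ∉ˡ xs

    Fresh-++⁻ˡ : ∀ {xs ys} → Fresh (xs ++ ys) → Fresh xs
    Fresh-++⁻ˡ fr b = fr b ∘ ∈-++⁺ˡ

    Fresh-++⁻ʳ : ∀ xs {ys} → Fresh (xs ++ ys) → Fresh ys
    Fresh-++⁻ʳ xs fr b = fr b ∘ ∈-++⁺ʳ xs

    Fresh-concatMap⁻ : ∀ {A : Set} {f : A → List (Fin n)} {xs x} →
      Fresh (concatMap f xs) → x ∈ˡ xs → Fresh (f x)
    Fresh-concatMap⁻ {f = f} fr x∈xs b pb∈ = fr b (∈-concatMap⁺ f (lose x∈xs pb∈))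

    Fresh-head : ∀ {i xs} → Fresh (i ∷ xs) → Avoids (inj₁ i)
    Fresh-head fr b = fr b ∘ here

    Fresh-tail : ∀ {i xs} → Fresh (i ∷ xs) → Fresh xs
    Fresh-tail fr b = fr b ∘ there

    Represents : Fin n → Value n → Set
    Represents a u = a ≡ embed u × Avoids u

    -- The v-variables are compared on xs only: in ∃x(x = index{𝕩 : α} ∧ φ), the
    -- formula α is evaluated symbolically before x has a value.
    record Matches (xs : List VVar) (val : Valuation 𝔸) (env : Env n) : Set where
      field
        v-match : ∀ y → y ∈ˡ xs → Represents (vval val y) (vvalᵉ env y)
        n-match : ∀ 𝕪 → nval val 𝕪 ≡ nvalᵉ env 𝕪
        r-match : ∀ X as → rval val X as ⇔ encode as ∈ rvalᵉ env X

    open Matches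

    restrict : ∀ {xs ys val env} → (∀ {y} → y ∈ˡ xs → y ∈ˡ ys) →
      Matches ys val env → Matches xs val env
    restrict xs⊆ys M = record
      { v-match = λ y → v-match M y ∘ xs⊆ys ; n-match = n-match M ; r-match = r-match M }

    module _ {xs : List VVar} where

      Matches-↦ⁿ : ∀ {val env} → Matches xs val env → ∀ 𝕩 a →
        Matches xs (val [ 𝕩 ↦ⁿ a ]) (env [ 𝕩 ↦ⁿ a ]ᵉ)
      Matches-↦ⁿ M 𝕩 a = record
        { v-match = v-match M
        ; n-match = update-related ℕ._≟_ (λ _ → _≡_) 𝕩 (λ 𝕪 _ → n-match M 𝕪) refl
        ; r-match = r-match M
        }

      Matches-↦ⁿˢ : ∀ {val env k} → Matches xs val env → ∀ (𝕩s : Vec NVar k) as →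
        Matches xs (val [ 𝕩s ↦ⁿˢ as ]) (env [ 𝕩s ↦ⁿˢ as ]ᵉ)
      Matches-↦ⁿˢ M []       []       = M
      Matches-↦ⁿˢ M (𝕩 ∷ 𝕩s) (a ∷ as) = Matches-↦ⁿˢ (Matches-↦ⁿ M 𝕩 a) 𝕩s as

      Matches-↦ʳ : ∀ {val env} → Matches xs val env → ∀ X {P S} →
        (∀ as → P as ⇔ encode as ∈ S) → Matches xs (val [ X ↦ʳ P ]) (env [ X ↦ʳ S ]ᵉ)
      Matches-↦ʳ M X P⇔S = record
        { v-match = v-match M
        ; n-match = n-match M
        ; r-match = update-related (≡-dec ℕ._≟_ ℕ._≟_)
                      (λ Y (P : Pred (Vec (Fin m) (arity Y)) 0ℓ) (S : Subset (m ^ arity Y)) →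
                        ∀ as → P as ⇔ encode as ∈ S) X
                      (λ Y _ → r-match M Y) P⇔S
        }

    Matches-↦ᵛ : ∀ {xs ys val env x a u} → (∀ {y} → y ∈ˡ ys → x ≢ y → y ∈ˡ xs) →
      Matches xs val env → Represents a u → Matches ys (val [ x ↦ᵛ a ]) (env [ x ↦ᵛ u ]ᵉ)
    Matches-↦ᵛ {ys = ys} ys⊆ M a~u = record
      { v-match = update-related ℕ._≟_ (λ y a u → y ∈ˡ ys → Represents a u) _
                    (λ y x≢y y∈ → v-match M y (ys⊆ y∈ x≢y)) (λ _ → a~u)
      ; n-match = n-match M
      ; r-match = r-match M
      }

    -- Meant for `α` in `∃index`: the semantics assigns `x` before evaluating `α`, the symbolic
    -- evaluation only afterwards.
    Matches-↦ᵛ-unused : ∀ {xs ys val env x a} → (∀ {y} → y ∈ˡ ys → x ≢ y × y ∈ˡ xs) →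
      Matches xs val env → Matches ys (val [ x ↦ᵛ a ]) env
    Matches-↦ᵛ-unused {val = val} {env} ys⊆ M = record
      { v-match = λ y y∈ → let x≢y , y∈xs = ys⊆ y∈ in
          subst (λ a → Represents a (vvalᵉ env y))
            (sym (update-other ℕ._≟_ (vval val) x≢y)) (v-match M y y∈xs)
      ; n-match = n-match M
      ; r-match = r-match M
      }

    ⟦⟧-represents : ∀ t {val env} → Matches (fvᵗ t) val env → Represents (⟦ t ⟧ val) (evalᵗ t env)
    ⟦⟧-represents (var x)    M = v-match M x (here refl)
    ⟦⟧-represents (con e)    M = refl , tt
    ⟦⟧-represents (fun f ts) M = refl , tt

    represents-≡⇔ : ∀ {a b u v} → Represents a u → Represents b v → a ≡ b ⇔ u ≡ v
    represents-≡⇔ (refl , u∌) (refl , v∌) = mk⇔ (embed-injective u∌ v∌) (cong embed)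

    map-nval : ∀ {xs val env k} → Matches xs val env → (𝕩s : Vec NVar k) →
      Vec.map (nval val) 𝕩s ≡ Vec.map (nvalᵉ env) 𝕩s
    map-nval M = map-cong (n-match M)

    -- By induction on the formula. Since `eval φ env` does not involve `p`, all `p` that avoid
    -- `reached φ env` give `φ` the same truth value under matching valuations.
    eval-sound : ∀ φ → NoVOrder φ → ∀ {val env} → Matches (fv φ) val env →
      Fresh (reached φ env) → 𝔸 ∣ val ⊨ φ ⇔ T (eval φ env)

    index-sound : ∀ 𝕩 φ → NoVOrder φ → ∀ {val env} → Matches (fv φ) val env →
      Fresh (concatMap (λ j → reached φ (env [ 𝕩 ↦ⁿ j ]ᵉ)) (allFin m)) →
      ∀ {i} → IsIndex i (λ j → 𝔸 ∣ val [ 𝕩 ↦ⁿ j ] ⊨ φ) ⇔ i ≡ defined 𝕩 φ env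
    index-sound 𝕩 φ o M fr = isIndex⇔≡indexOf full λ j →
      eval-sound φ o (Matches-↦ⁿ M 𝕩 j) (Fresh-concatMap⁻ fr (∈-allFin j))

    eval-sound (s ≐ t) _ M _ = ⇔-trans
      (represents-≡⇔ (⟦⟧-represents s (restrict ∈-++⁺ˡ M))
                     (⟦⟧-represents t (restrict (∈-++⁺ʳ (fvᵗ s)) M)))
      (⌊⌋⇔ _)
    eval-sound (𝕩 ≤ⁿ 𝕪) _ {env = env} M _ rewrite n-match M 𝕩 | n-match M 𝕪 =
      ⌊⌋⇔ (nvalᵉ env 𝕩 Fin.≤? nvalᵉ env 𝕪)
    eval-sound (rel R ts) _ M _ = mk⇔ id id
    eval-sound (rvar X 𝕩s) _ M _ rewrite map-nval M 𝕩s = ⇔-trans (r-match M X _) (⌊⌋⇔ _)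
    eval-sound (φ ∧ ψ) (oφ , oψ) {env = env} M fr = ⇔-trans
      (eval-sound φ oφ (restrict ∈-++⁺ˡ M) (Fresh-++⁻ˡ fr)
        ×-⇔ eval-sound ψ oψ (restrict (∈-++⁺ʳ (fv φ)) M) (Fresh-++⁻ʳ (reached φ env) fr))
      (⇔-sym Bool.T-∧)
    eval-sound (~ φ) o M fr = ⇔-trans (¬-cong-⇔ (eval-sound φ o M fr)) (T-not⇔ _)
    eval-sound (ifp X x̄ φ ȳ) o {val} {env} M fr rewrite map-nval M ȳ = ⇔-trans
      -- The semantic fixed point is the union of all stages; each lies in stage `N`, which is
      -- itself one of them.
      (mk⇔ (λ (i , h) → stage⊆limit F i (to (stage-sound i _) h))
           (λ h → N , from (stage-sound N _) h))
      (⌊⌋⇔ _)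
      where
      N = m ^ arity X

      F = operator X x̄ φ env

      G : Pred (Vec (Fin m) (arity X)) 0ℓ → Pred (Vec (Fin m) (arity X)) 0ℓ
      G S ā = 𝔸 ∣ val [ X ↦ʳ S ] [ x̄ ↦ⁿˢ ā ] ⊨ φ

      -- The list in `fr` covers stages 0 to `N` and tuples `decode a`; `i ⊓ N` and `encode ā` bring
      -- every `i` and `ā` into that range.
      fresh : ∀ i ā → Fresh (reached φ (env [ X ↦ʳ stage F i ]ᵉ [ x̄ ↦ⁿˢ ā ]ᵉ))
      fresh i ā =
        subst (λ S → Fresh (reached φ (env [ X ↦ʳ S ]ᵉ [ x̄ ↦ⁿˢ ā ]ᵉ))) (stage-⊓ F i)
          (subst (λ ā → Fresh (reached φ (env [ X ↦ʳ stage F (i ⊓ N) ]ᵉ [ x̄ ↦ⁿˢ ā ]ᵉ)))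
            (decode∘encode ā)
            (Fresh-concatMap⁻ (Fresh-concatMap⁻ fr (∈-upTo⁺ (s≤s (ℕ.m⊓n≤n i N))))
              (∈-allFin (encode ā))))

      -- The induction hypothesis at `i` is the match for `X` under which the body is evaluated at
      -- the next stage.
      stage-sound : ∀ i ā → Stage G i ā ⇔ encode ā ∈ stage F i
      stage-sound zero    ā = mk⇔ (λ ()) (λ ∈∅ → contradiction ∈∅ ∉⊥)
      stage-sound (suc i) ā = ⇔-trans (stage-sound i ā ⊎-⇔ step) (⇔-sym ∪⇔⊎)
        where
        step : G (Stage G i) ā ⇔ encode ā ∈ F (stage F i)
        step = ⇔-trans
          (subst (λ ā′ → G (Stage G i) ā ⇔ T (eval φ (env [ X ↦ʳ stage F i ]ᵉ [ x̄ ↦ⁿˢ ā′ ]ᵉ)))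
            (sym (decode∘encode ā))
            (eval-sound φ o (Matches-↦ⁿˢ (Matches-↦ʳ M X (stage-sound i)) x̄ ā) (fresh i ā)))
          (⇔-sym ∈-tabulate)
    eval-sound (t ≐index 𝕩 ∶ φ) o M fr = ⇔-trans
      (index-sound 𝕩 φ o (restrict (∈-++⁺ʳ (fvᵗ t)) M) (Fresh-tail fr))
      (⇔-trans
        -- The list starts with the index itself; as `p` avoids it, `inj₁` represents it.
        (represents-≡⇔ (⟦⟧-represents t (restrict ∈-++⁺ˡ M)) (refl , Fresh-head fr))
        (⌊⌋⇔ _))
    eval-sound (∃index x 𝕩 α x∉α φ) (oα , oφ) {val} {env} M fr = mk⇔
      (λ (i , is-index , h) → to (φ-sound (to (α-sound i) is-index)) h)
      (λ h → defined 𝕩 α env , from (α-sound _) refl , from (φ-sound refl) h)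
      where
      keep : ∀ {y} → y ∈ˡ fv α ++ fv φ → x ≢ y → y ∈ˡ fv (∃index x 𝕩 α x∉α φ)
      keep y∈ x≢y = ∈-filter⁺ (λ y → ¬? (y ℕ.≟ x)) y∈ (x≢y ∘ sym)

      α-sound : ∀ i →
        IsIndex (⟦ var x ⟧ (val [ x ↦ᵛ i ])) (λ j → 𝔸 ∣ val [ x ↦ᵛ i ] [ 𝕩 ↦ⁿ j ] ⊨ α) ⇔
        i ≡ defined 𝕩 α env
      α-sound i rewrite update-same ℕ._≟_ (vval val) x {i} =
        index-sound 𝕩 α oα
          (Matches-↦ᵛ-unused
            -- The side condition on `∃index` enters here.
            (λ y∈α → let x≢y = λ { refl → x∉α y∈α } in x≢y , keep (∈-++⁺ˡ y∈α) x≢y) M)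
          (Fresh-tail (Fresh-++⁻ˡ fr))

      φ-sound : ∀ {i} → i ≡ defined 𝕩 α env →
        𝔸 ∣ val [ x ↦ᵛ i ] ⊨ φ ⇔ T (eval φ (env [ x ↦ᵛ inj₁ (defined 𝕩 α env) ]ᵉ))
      φ-sound refl = eval-sound φ oφ
        (Matches-↦ᵛ (keep ∘ ∈-++⁺ʳ (fv α)) M (refl , Fresh-head fr))
        (Fresh-++⁻ʳ (defined 𝕩 α env ∷ concatMap _ (allFin m)) fr)
    eval-sound (∃ⁿ 𝕩 φ) o M fr = ⇔-trans
      (mk⇔ (λ (j , h) → j , to (sound j) h) (λ (j , h) → j , from (sound j) h))
      (⌊⌋⇔ (Fin.any? _))
      where
      sound = λ j → eval-sound φ o (Matches-↦ⁿ M 𝕩 j) (Fresh-concatMap⁻ fr (∈-allFin j))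

  -- A polynomial bound on the number of reached indices

  module _ (2≤m : 2 ℕ.≤ m) where

    length-reached : ∀ φ env → length (reached φ env) ℕ.≤ m ^ degree φ

    length-reached-allFin : ∀ φ 𝕩 env →
      length (concatMap (λ j → reached φ (env [ 𝕩 ↦ⁿ j ]ᵉ)) (allFin m)) ℕ.≤ m ^ suc (degree φ)
    length-reached-allFin φ 𝕩 env = begin
      length (concatMap (λ j → reached φ (env [ 𝕩 ↦ⁿ j ]ᵉ)) (allFin m))
        ≤⟨ length-concatMap-≤ _ (allFin m) (λ j → length-reached φ (env [ 𝕩 ↦ⁿ j ]ᵉ)) ⟩
      length (allFin m) * m ^ degree φ
        ≡⟨ cong (_* m ^ degree φ) (length-tabulate {n = m} id) ⟩
      m ^ suc (degree φ) ∎
      where open ℕ.≤-Reasoning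

    length-reached (s ≤ᵛ t)           env = z≤n
    length-reached (s ≐ t)            env = z≤n
    length-reached (𝕩 ≤ⁿ 𝕪)           env = z≤n
    length-reached (rel R ts)         env = z≤n
    length-reached (rvar X 𝕩s)        env = z≤n
    length-reached (φ ∧ ψ)            env rewrite length-++ (reached φ env) {reached ψ env} =
      +≤^ (degree φ) (degree ψ) 2≤m (length-reached φ env) (length-reached ψ env)
    length-reached (~ φ)              env = length-reached φ env
    length-reached (ifp X x̄ φ ȳ)      env = begin
      length (reached (ifp X x̄ φ ȳ) env)
        ≤⟨ length-concatMap-≤ (λ i → concatMap (at i) (allFin N)) (upTo (suc N)) (λ i →
             length-concatMap-≤ (at i) (allFin N) (λ a → length-reached φ _)) ⟩
      length (upTo (suc N)) * (length (allFin N) * m ^ degree φ)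
        ≡⟨ cong₂ (λ a b → a * (b * m ^ degree φ))
             (length-upTo (suc N)) (length-tabulate {n = N} id) ⟩
      suc N * (N * m ^ degree φ)
        -- `suc N` is `m ^ 0 + m ^ arity X`.
        ≤⟨ ℕ.*-monoˡ-≤ _ (+≤^ 0 (arity X) 2≤m ℕ.≤-refl ℕ.≤-refl) ⟩
      m ^ suc (arity X) * (N * m ^ degree φ)
        ≡⟨ cong (m ^ suc (arity X) *_) (ℕ.^-distribˡ-+-* m (arity X) (degree φ)) ⟨
      m ^ suc (arity X) * m ^ (arity X + degree φ)
        ≡⟨ ℕ.^-distribˡ-+-* m (suc (arity X)) _ ⟨
      m ^ degree (ifp X x̄ φ ȳ) ∎
      where
      open ℕ.≤-Reasoning
      N = m ^ arity X
      at = λ i (a : Fin N) →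
        reached φ (env [ X ↦ʳ stage (operator X x̄ φ env) i ]ᵉ [ x̄ ↦ⁿˢ decode a ]ᵉ)
    length-reached (t ≐index 𝕩 ∶ φ)   env =
      -- The exponent 0 counts the single index at the head of the list.
      +≤^ 0 (suc (degree φ)) 2≤m ℕ.≤-refl (length-reached-allFin φ 𝕩 env)
    length-reached (∃index x 𝕩 α _ φ) env
      rewrite length-++
                (defined 𝕩 α env ∷ concatMap (λ j → reached α (env [ 𝕩 ↦ⁿ j ]ᵉ)) (allFin m))
                {reached φ (env [ x ↦ᵛ inj₁ (defined 𝕩 α env) ]ᵉ)} =
      +≤^ (suc (suc (degree α))) (degree φ) 2≤m
        (+≤^ 0 (suc (degree α)) 2≤m ℕ.≤-refl (length-reached-allFin α 𝕩 env))
        (length-reached φ _)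
    length-reached (∃ⁿ 𝕩 φ)           env = length-reached-allFin φ 𝕩 env

  -- Exchanging the values of the two constants

  undefinable : ∀ {d} → c ≢ d → 2 ℕ.≤ m → ∀ φ → NoVOrder φ → m ^ (2 + degree φ) ℕ.< n →
    ¬ (φ ≋ (con c ≤ᵛ con d))
  undefinable {d} c≢d 2≤m φ o small φ≋ =
    [ (λ i≤j → i≢j (Fin.≤-antisym i≤j (to swap i≤j)))
    , (λ j≤i → i≢j (Fin.≤-antisym (from swap j≤i) j≤i))
    ] (Fin.≤-total i j)
    where
    env : Env n
    -- `inj₂ true` represents `p true` for every `p`, so one environment serves both choices of `p`.
    -- `2≤m` also reads `1 < m`, so number variables take the value 1.
    env = record { vvalᵉ = λ _ → inj₂ true ; nvalᵉ = λ _ → fromℕ< 2≤m ; rvalᵉ = λ _ → ∅ˢ }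

    1≤m^1 : 1 ℕ.≤ m ^ 1
    1≤m^1 = subst (1 ℕ.≤_) (sym (ℕ.*-identityʳ m)) (ℕ.<⇒≤ 2≤m)

    -- Two elements are drawn in turn, and the second must also avoid the first, kept in `ys`.
    -- Bounding its length by `m ^ 1` yields the exponent `2 + degree φ`.
    avoidable : ∀ ys → length ys ℕ.≤ 1 → ∃[ i ] i ∉ˡ ys ++ reached φ env
    avoidable ys |ys|≤1 = ∃-∉ _ (ℕ.≤-<-trans
      (ℕ.≤-trans (ℕ.≤-reflexive (length-++ ys))
        (+≤^ 1 (degree φ) 2≤m (ℕ.≤-trans |ys|≤1 1≤m^1) (length-reached 2≤m φ env)))
      small)

    i j : Fin n
    i = proj₁ (avoidable [] z≤n)
    j = proj₁ (avoidable (i ∷ []) (s≤s z≤n))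

    i≢j : i ≢ j
    i≢j i≡j = proj₂ (avoidable (i ∷ []) (s≤s z≤n)) (here (sym i≡j))

    choose : Bool → Fin n
    choose b = if b then i else j

    choose-fresh : ∀ b → choose b ∉ˡ reached φ env
    choose-fresh true  = proj₂ (avoidable [] z≤n)
    choose-fresh false = proj₂ (avoidable (i ∷ []) (s≤s z≤n)) ∘ there

    choose-injective : Injective _≡_ _≡_ choose
    choose-injective {true}  {true}  _  = refl
    choose-injective {true}  {false} eq = contradiction eq i≢j
    choose-injective {false} {true}  eq = contradiction (sym eq) i≢j
    choose-injective {false} {false} _  = refl

    module _ (p : Bool → Fin n) (p-injective : Injective _≡_ _≡_ p) where

      open Soundness p p-injective

      ordered⇔eval : Fresh (reached φ env) → p true ≤ p false ⇔ T (eval φ env)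
      ordered⇔eval fresh = ⇔-trans
        (subst (λ (a , b) → p a ≤ p b ⇔ 𝔸 ∣ val ⊨ φ)
          -- These equations turn the interpretations of `c` and `d` in `𝔸` into `p true` and
          -- `p false`.
          (cong₂ _,_ (dec-true (c Fin.≟ c) refl) (dec-false (d Fin.≟ c) (c≢d ∘ sym)))
          (⇔-sym (φ≋ 𝔸 val)))
        (eval-sound φ o matches fresh)
        where
        val : Valuation 𝔸
        val = record { vval = λ _ → p true ; nval = λ _ → fromℕ< 2≤m ; rval = λ _ _ → ⊥ }

        matches : Matches (fv φ) val env
        matches = record
          { v-match = λ _ _ → refl , tt
          ; n-match = λ _ → refl
          ; r-match = λ _ _ → mk⇔ (λ ()) (λ ∈∅ → contradiction ∈∅ ∉⊥)
          }

    -- `choose` and `choose ∘ not` have the same values, so both are fresh, and both orderings are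
    -- equivalent to the same Boolean `eval φ env`.
    swap : i ≤ j ⇔ j ≤ i
    swap = ⇔-trans (ordered⇔eval choose choose-injective choose-fresh)
      (⇔-sym (ordered⇔eval (choose ∘ not) (Bool.not-injective ∘ choose-injective)
        (choose-fresh ∘ not)))

-- Exponential against polynomial growth, and the conclusion

n<2^n : ∀ n → n ℕ.< 2 ^ n
n<2^n zero    = s≤s z≤n
n<2^n (suc n) = begin-strict
  1 + n         <⟨ ℕ.+-mono-≤-< (ℕ.m^n>0 2 n) (n<2^n n) ⟩
  2 ^ n + 2 ^ n ≡⟨ cong (2 ^ n +_) (ℕ.+-identityʳ _) ⟨
  2 ^ suc n     ∎
  where open ℕ.≤-Reasoning

-- With `m = 2 ^ r` the claim becomes `r * k < 2 ^ r`. For `r = 2 * (k + 1)` the right side is the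
-- square of `2 ^ suc k`, which bounds both `r` and `suc k`.
exponential-beats-power : ∀ k → ∃[ m ] 2 ℕ.≤ m × m ^ k ℕ.< 2 ^ m
exponential-beats-power k = 2 ^ r , 2≤2^r , (begin-strict
  (2 ^ r) ^ k ≡⟨ ℕ.^-*-assoc 2 r k ⟩
  2 ^ (r * k) <⟨ ℕ.^-monoʳ-< 2 (s≤s (s≤s z≤n)) rk<2^r ⟩
  2 ^ (2 ^ r) ∎)
  where
  open ℕ.≤-Reasoning
  r = suc k + suc k

  2≤2^r : 2 ℕ.≤ 2 ^ r
  2≤2^r = ℕ.^-monoʳ-≤ 2 {1} {r} (s≤s z≤n)

  r≤2^1+k : r ℕ.≤ 2 ^ suc k
  r≤2^1+k = begin
    suc k + suc k ≤⟨ ℕ.+-mono-≤ (n<2^n k) (n<2^n k) ⟩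
    2 ^ k + 2 ^ k ≡⟨ cong (2 ^ k +_) (ℕ.+-identityʳ _) ⟨
    2 ^ suc k     ∎

  rk<2^r : r * k ℕ.< 2 ^ r
  rk<2^r = begin-strict
    r * k                 <⟨ ℕ.*-monoʳ-< r (ℕ.n<1+n k) ⟩
    r * suc k             ≤⟨ ℕ.*-mono-≤ r≤2^1+k (ℕ.<⇒≤ (n<2^n (suc k))) ⟩
    2 ^ suc k * 2 ^ suc k ≡⟨ ℕ.^-distribˡ-+-* 2 (suc k) (suc k) ⟨
    2 ^ r                 ∎

theorem3 : (σ : Vocabulary) (c d : Fin (#con σ)) → c ≢ d →
    ¬ (∃[ φ ] NoVOrder φ × φ ≋ (con {σ} c ≤ᵛ con d))
theorem3 σ c d c≢d (φ , o , φ≋) with exponential-beats-power (2 + degree φ)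
... | m , 2≤m , small =
  Evaluation.undefinable c full c≢d (subst (2 ℕ.≤_) (sym log≡m) 2≤m) φ o
    (subst (λ k → k ^ (2 + degree φ) ℕ.< 2 ^ m) (sym log≡m) small) φ≋
  where
  -- The domain has size `2 ^ m`, a power of two, so that `full` holds with equality.
  log≡m : ⌈log₂ 2 ^ m ⌉ ≡ m
  log≡m = ⌈log₂2^n⌉≡n m

  full : 2 ^ ⌈log₂ 2 ^ m ⌉ ℕ.≤ 2 ^ m
  full = ℕ.≤-reflexive (cong (2 ^_) log≡m)
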